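{- The variety of Łukasiewicz near semirings is congruence regular, with witness terms $$t_1(x,y,z)=\big((x\cdot\alpha(y))+(y\cdot\alpha(x))\big)+z,\qquad t_2(x,y,z)=\alpha\big((x\cdot\alpha(y))+(y\cdot\alpha(x))\big)\cdot z.$$ That is, in every Łukasiewicz near semiring and for all elements $x,y,z$ one has $t_1(x,y,z)=t_2(x,y,z)=z$ if and only if $x=y$; and every Łukasiewicz near semiring is congruence regular.
   Context: A near semiring is an algebra $\langle R,+,\cdot,0,1\rangle$ such that: (i) $\langle R,+,0\rangle$ is a commutative monoid; (ii) $x\cdot 1=x=1\cdot x$ (multiplication need not be associative or commutative); (iii) $(x+y)\cdot z=(x\cdot z)+(y\cdot z)$; (iv) $x\cdot 0=0\cdot x=0$. It is idempotent if $x+x=x$; then $x\le y$ iff $x+y=y$ defines a partial order, called the induced order. An involutive near semiring is an idempotent near semiring with a map $\alpha:R\to R$ such that $\alpha(\alpha(x))=x$, and $x\le y$ implies $\alpha(y)\le\alpha(x)$. A Łukasiewicz near semiring is an involutive near semiring satisfying the identity $\alpha(x\cdot\alpha(y))\cdot\alpha(y)=\alpha(y\cdot\alpha(x))\cdot\alpha(x)$. An algebra $\mathbf{A}$ is congruence regular if for all congruences $\theta,\phi$ of $\mathbf{A}$ and every $a\in A$, $[a]_\theta=[a]_\phi$ implies $\theta=\phi$. A variety is congruence regular if all its members are. By a theorem of Csákány, a variety is congruence regular iff there are ternary terms $t_i(x,y,z)$, $i\ge 1$, such that in its members $t_i(x,y,z)=z$ for all $i$ holds if and only if $x=y$; such terms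 are called witness terms. Congruences are with respect to all operations $+,\cdot,\alpha,0,1$. -}

module Defs where

open import Level using (Level; suc; _⊔_)
open import Algebra.Core using (Op₁; Op₂)
import Algebra.Definitions as AlgDefs
open import Algebra.Structures using (IsCommutativeMonoid)
open import Relation.Binary.Core using (Rel; _⇒_; _⇔_)
open import Relation.Binary.Structures using (IsEquivalence)
open import Relation.Unary using (Pred; _≐_)

private
  variable
    a c ℓ : Level

module _ {A : Set a} (_≈_ : Rel A ℓ) where

  open AlgDefs _≈_

  -- Unlike the near semirings of `Algebra.Structures`, these have a unit and
  -- a two-sided absorbing zero, and multiplication is not assumed associative.
  record IsUnitalNearSemiring (_+_ _*_ : Op₂ A) (0# 1# : A) : Set (a ⊔ ℓ) where
    field
      +-isCommutativeMonoid : IsCommutativeMonoid _≈_ _+_ 0#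
      *-cong                : Congruent₂ _*_
      *-identity            : Identity 1# _*_
      distribʳ              : _*_ DistributesOverʳ _+_
      zero                  : Zero 0# _*_

    open IsCommutativeMonoid +-isCommutativeMonoid public
      using (isEquivalence; setoid)
      renaming
        ( assoc    to +-assoc
        ; comm     to +-comm
        ; identity to +-identity
        ; ∙-cong   to +-cong
        )
    open IsEquivalence isEquivalence public

  record IsIdempotentNearSemiring (_+_ _*_ : Op₂ A) (0# 1# : A) : Set (a ⊔ ℓ) where
    field
      isUnitalNearSemiring : IsUnitalNearSemiring _+_ _*_ 0# 1#
      +-idem               : Idempotent _+_

    open IsUnitalNearSemiring isUnitalNearSemiring public

    infix 4 _≤_
    _≤_ : Rel A ℓ
    x ≤ y = (x + y) ≈ y

  record IsInvolutiveNearSemiring (_+_ _*_ : Op₂ A) (α : Op₁ A) (0# 1# : A) : Set (a ⊔ ℓ) where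
    field
      isIdempotentNearSemiring : IsIdempotentNearSemiring _+_ _*_ 0# 1#

    open IsIdempotentNearSemiring isIdempotentNearSemiring public

    field
      α-cong       : Congruent₁ α
      α-involutive : Involutive α
      α-antitone   : ∀ {x y} → x ≤ y → α y ≤ α x

  record IsŁukasiewiczNearSemiring (_+_ _*_ : Op₂ A) (α : Op₁ A) (0# 1# : A) : Set (a ⊔ ℓ) where
    field
      isInvolutiveNearSemiring : IsInvolutiveNearSemiring _+_ _*_ α 0# 1#
      łukasiewicz : ∀ x y → (α (x * α y) * α y) ≈ (α (y * α x) * α x)

    open IsInvolutiveNearSemiring isInvolutiveNearSemiring public

record RawInvolutiveNearSemiring c ℓ : Set (suc (c ⊔ ℓ)) where
  infix  4 _≈_
  infixl 7 _*_
  infixl 6 _+_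
  field
    Carrier : Set c
    _≈_     : Rel Carrier ℓ
    _+_     : Op₂ Carrier
    _*_     : Op₂ Carrier
    α       : Op₁ Carrier
    0#      : Carrier
    1#      : Carrier

record ŁukasiewiczNearSemiring c ℓ : Set (suc (c ⊔ ℓ)) where
  field
    raw : RawInvolutiveNearSemiring c ℓ

  open RawInvolutiveNearSemiring raw public

  field
    isŁukasiewiczNearSemiring : IsŁukasiewiczNearSemiring _≈_ _+_ _*_ α 0# 1#

  open IsŁukasiewiczNearSemiring isŁukasiewiczNearSemiring public

module _ (R : RawInvolutiveNearSemiring c ℓ) where

  open RawInvolutiveNearSemiring R

  -- A congruence must contain the setoid equality, since equal elements are
  -- congruent. Compatibility with the constants 0# and 1# is reflexivity.
  record Congruence ℓ′ : Set (c ⊔ ℓ ⊔ suc ℓ′) where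
    infix 4 _∼_
    field
      _∼_           : Rel Carrier ℓ′
      isEquivalence : IsEquivalence _∼_
      ≈⇒∼           : _≈_ ⇒ _∼_
      +-cong        : AlgDefs.Congruent₂ _∼_ _+_
      *-cong        : AlgDefs.Congruent₂ _∼_ _*_
      α-cong        : AlgDefs.Congruent₁ _∼_ α

    [_] : Carrier → Pred Carrier ℓ′
    [ x ] = x ∼_

  CongruenceRegular : (ℓ₁ ℓ₂ : Level) → Set (c ⊔ ℓ ⊔ suc (ℓ₁ ⊔ ℓ₂))
  CongruenceRegular ℓ₁ ℓ₂ =
    (θ : Congruence ℓ₁) (φ : Congruence ℓ₂) (x : Carrier) →
    Congruence.[_] θ x ≐ Congruence.[_] φ x →
    Congruence._∼_ θ ⇔ Congruence._∼_ φ

  t₁ t₂ : Carrier → Carrier → Carrier → Carrier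
  t₁ x y z = ((x * α y) + (y * α x)) + z
  t₂ x y z = α ((x * α y) + (y * α x)) * z

{-# OPTIONS --safe #-}

-- If t₁ and t₂ fix z, then s = x·α(y) + y·α(x) satisfies s ≤ z and α(s)·z = z,
-- and the Łukasiewicz identity at (α(s), α(z)) forces s = 0. Both summands of s
-- then vanish, and the identity at (x, y) collapses to α(y) = α(x). Regularity
-- follows by applying this in the quotient by a congruence, which is again a
-- Łukasiewicz near semiring.
module Submission where

open import Defs
open import Data.Product using (_×_; _,_; proj₁; proj₂)
open import Function.Base using (_∘_)
open import Function.Bundles using (_⇔_; mk⇔)
open import Relation.Binary.Core using (_⇒_)
open import Relation.Binary.Structures using (IsEquivalence)
open import Relation.Unary using (_⊆_)
import Relation.Binary.Reasoning.Setoid as ≈-Reasoning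

module Properties {c ℓ} (R : ŁukasiewiczNearSemiring c ℓ) where

  open ŁukasiewiczNearSemiring R
  open ≈-Reasoning setoid

  +-identityˡ : ∀ x → 0# + x ≈ x
  +-identityˡ = proj₁ +-identity

  +-identityʳ : ∀ x → x + 0# ≈ x
  +-identityʳ = proj₂ +-identity

  *-identityˡ : ∀ x → 1# * x ≈ x
  *-identityˡ = proj₁ *-identity

  zeroˡ : ∀ x → 0# * x ≈ 0#
  zeroˡ = proj₁ zero

  zeroʳ : ∀ x → x * 0# ≈ 0#
  zeroʳ = proj₂ zero

  x≤x+y : ∀ x y → x ≤ x + y
  x≤x+y x y = begin
    x + (x + y)  ≈⟨ +-assoc x x y ⟨
    (x + x) + y  ≈⟨ +-cong (+-idem x) refl ⟩
    x + y        ∎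

  x≤0⇒x≈0 : ∀ {x} → x ≤ 0# → x ≈ 0#
  x≤0⇒x≈0 x≤0 = trans (sym (+-identityʳ _)) x≤0

  -- Distributivity acts on the left factor, so order arguments below always vary that factor.
  *-monoˡ-≤ : ∀ {x y} z → x ≤ y → x * z ≤ y * z
  *-monoˡ-≤ {x} {y} z x≤y = trans (sym (distribʳ z x y)) (*-cong x≤y refl)

  *-nullˡ : ∀ {x y z} → x ≤ y → y * z ≈ 0# → x * z ≈ 0#
  *-nullˡ {x} {y} {z} x≤y yz≈0 = x≤0⇒x≈0 (begin
    x * z + 0#     ≈⟨ +-cong refl yz≈0 ⟨
    x * z + y * z  ≈⟨ *-monoˡ-≤ z x≤y ⟩
    y * z          ≈⟨ yz≈0 ⟩
    0#             ∎)

  x+y≈0⇒x≈0 : ∀ {x y} → x + y ≈ 0# → x ≈ 0#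
  x+y≈0⇒x≈0 {x} {y} x+y≈0 = x≤0⇒x≈0 (begin
    x + 0#       ≈⟨ +-cong refl x+y≈0 ⟨
    x + (x + y)  ≈⟨ x≤x+y x y ⟩
    x + y        ≈⟨ x+y≈0 ⟩
    0#           ∎)

  x+y≈0⇒y≈0 : ∀ {x y} → x + y ≈ 0# → y ≈ 0#
  x+y≈0⇒y≈0 x+y≈0 = x+y≈0⇒x≈0 (trans (+-comm _ _) x+y≈0)

  -- The antitone involution sends the bottom `0#` to a top: `0# ≤ α x` is turned around.
  x≤α0 : ∀ x → x ≤ α 0#
  x≤α0 x = begin
    x + α 0#        ≈⟨ +-cong (α-involutive x) refl ⟨
    α (α x) + α 0#  ≈⟨ α-antitone (+-identityˡ (α x)) ⟩
    α 0#            ∎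

  -- At the pair `0#`, `1#` the Łukasiewicz identity reduces by the zero and unit laws alone.
  α0*α1≈0 : α 0# * α 1# ≈ 0#
  α0*α1≈0 = begin
    α 0# * α 1#           ≈⟨ *-cong (α-cong (zeroˡ (α 1#))) refl ⟨
    α (0# * α 1#) * α 1#  ≈⟨ łukasiewicz 0# 1# ⟩
    α (1# * α 0#) * α 0#  ≈⟨ *-cong (α-cong (*-identityˡ (α 0#))) refl ⟩
    α (α 0#) * α 0#       ≈⟨ *-cong (α-involutive 0#) refl ⟩
    0# * α 0#             ≈⟨ zeroˡ (α 0#) ⟩
    0#                    ∎

  -- Since `1# ≤ α 0#`, the product `1# * α 1#` lies below `α 0# * α 1#`, which vanishes.
  α1≈0 : α 1# ≈ 0#
  α1≈0 = trans (sym (*-identityˡ (α 1#))) (*-nullˡ (x≤α0 1#) α0*α1≈0)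

  α0≈1 : α 0# ≈ 1#
  α0≈1 = trans (α-cong (sym α1≈0)) (α-involutive 1#)

  x≈0⇒αx*y≈y : ∀ {x} y → x ≈ 0# → α x * y ≈ y
  x≈0⇒αx*y≈y y x≈0 =
    trans (*-cong (trans (α-cong x≈0) α0≈1) refl) (*-identityˡ y)

  -- Against `1#`, one side of the Łukasiewicz identity ends in the factor `α 1#`, which is zero,
  -- and the other is `α (α x) * α x`.
  x*αx≈0 : ∀ x → x * α x ≈ 0#
  x*αx≈0 x = begin
    x * α x               ≈⟨ *-cong (α-involutive x) refl ⟨
    α (α x) * α x         ≈⟨ *-cong (α-cong (*-identityˡ (α x))) refl ⟨
    α (1# * α x) * α x    ≈⟨ łukasiewicz x 1# ⟨
    α (x * α 1#) * α 1#   ≈⟨ *-cong refl α1≈0 ⟩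
    α (x * α 1#) * 0#     ≈⟨ zeroʳ _ ⟩
    0#                    ∎

  αx*x≈0 : ∀ x → α x * x ≈ 0#
  αx*x≈0 x = trans (*-cong refl (sym (α-involutive x))) (x*αx≈0 (α x))

  x≤y∧αx*y≈y⇒x≈0 : ∀ {x y} → x ≤ y → α x * y ≈ y → x ≈ 0#
  x≤y∧αx*y≈y⇒x≈0 {x} {y} x≤y αx*y≈y = begin
    x                                 ≈⟨ x≈0⇒αx*y≈y x αy*x≈0 ⟨
    α (α y * x) * x                   ≈⟨ *-cong (α-cong (*-cong refl (α-involutive x))) (α-involutive x) ⟨
    α (α y * α (α x)) * α (α x)       ≈⟨ łukasiewicz (α x) (α y) ⟨
    α (α x * α (α y)) * α (α y)       ≈⟨ *-cong (α-cong (*-cong refl (α-involutive y))) (α-involutive y) ⟩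
    α (α x * y) * y                   ≈⟨ *-cong (α-cong αx*y≈y) refl ⟩
    α y * y                           ≈⟨ αx*x≈0 y ⟩
    0#                                ∎
    where
    αy*x≈0 : α y * x ≈ 0#
    -- From `α y ≤ α x`, the product `α y * x` lies below `α x * x`, which is zero.
    αy*x≈0 = *-nullˡ (α-antitone x≤y) (αx*x≈0 x)

  x*αy≈0∧y*αx≈0⇒x≈y : ∀ {x y} → x * α y ≈ 0# → y * α x ≈ 0# → x ≈ y
  x*αy≈0∧y*αx≈0⇒x≈y {x} {y} x*αy≈0 y*αx≈0 =
    trans (sym (α-involutive x)) (trans (α-cong αx≈αy) (α-involutive y))
    where
    αx≈αy : α x ≈ α y
    αx≈αy = begin
      α x                 ≈⟨ x≈0⇒αx*y≈y (α x) y*αx≈0 ⟨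
      α (y * α x) * α x   ≈⟨ łukasiewicz x y ⟨
      α (x * α y) * α y   ≈⟨ x≈0⇒αx*y≈y (α y) x*αy≈0 ⟩
      α y                 ∎

  witnesses⇒≈ : ∀ {x y z} → t₁ raw x y z ≈ z → t₂ raw x y z ≈ z → x ≈ y
  witnesses⇒≈ t₁≈z t₂≈z =
    -- By definition of the order, `t₁≈z` is itself the inequality `s ≤ z`.
    let s≈0 = x≤y∧αx*y≈y⇒x≈0 t₁≈z t₂≈z
    in x*αy≈0∧y*αx≈0⇒x≈y (x+y≈0⇒x≈0 s≈0) (x+y≈0⇒y≈0 s≈0)

  ≈⇒witnesses : ∀ {x y} z → x ≈ y → t₁ raw x y z ≈ z × t₂ raw x y z ≈ z
  ≈⇒witnesses {x} {y} z x≈y =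
    trans (+-cong s≈0 refl) (+-identityˡ z) , x≈0⇒αx*y≈y z s≈0
    where
    s≈0 : x * α y + y * α x ≈ 0#
    s≈0 = begin
      x * α y + y * α x  ≈⟨ +-cong (*-cong x≈y refl) (*-cong refl (α-cong x≈y)) ⟩
      y * α y + y * α y  ≈⟨ +-idem (y * α y) ⟩
      y * α y            ≈⟨ x*αx≈0 y ⟩
      0#                 ∎

module _ {c ℓ} (R : ŁukasiewiczNearSemiring c ℓ) where

  open ŁukasiewiczNearSemiring R
  open Properties R

  -- Carrier and operations stay the same and only the equality is coarsened, so equational axioms
  -- carry over by `≈⇒∼`, and `t₁`, `t₂` remain the same functions.
  quotient : ∀ {ℓ′} → Congruence raw ℓ′ → ŁukasiewiczNearSemiring c ℓ′
  quotient θ = record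
    { raw = record
      { Carrier = Carrier ; _≈_ = _∼_ ; _+_ = _+_ ; _*_ = _*_
      ; α = α ; 0# = 0# ; 1# = 1# }
    ; isŁukasiewiczNearSemiring = record
      { isInvolutiveNearSemiring = record
        { isIdempotentNearSemiring = record
          { isUnitalNearSemiring = record
            { +-isCommutativeMonoid = record
              { isMonoid = record
                { isSemigroup = record
                  { isMagma = record
                    { isEquivalence = θ.isEquivalence
                    ; ∙-cong        = θ.+-cong
                    }
                  ; assoc = λ x y z → ≈⇒∼ (+-assoc x y z)
                  }
                ; identity = (≈⇒∼ ∘ +-identityˡ) , (≈⇒∼ ∘ +-identityʳ)
                }
              ; comm = λ x y → ≈⇒∼ (+-comm x y)
              }
            ; *-cong     = θ.*-cong
            ; *-identity = (≈⇒∼ ∘ *-identityˡ) , (≈⇒∼ ∘ proj₂ *-identity)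
            ; distribʳ   = λ x y z → ≈⇒∼ (distribʳ x y z)
            ; zero       = (≈⇒∼ ∘ zeroˡ) , (≈⇒∼ ∘ zeroʳ)
            }
          ; +-idem = ≈⇒∼ ∘ +-idem
          }
        ; α-cong       = θ.α-cong
        ; α-involutive = ≈⇒∼ ∘ α-involutive
        ; α-antitone   = α-antitone-∼
        }
      ; łukasiewicz = λ x y → ≈⇒∼ (łukasiewicz x y)
      }
    }
    where
    module θ = Congruence θ
    open θ using (_∼_; ≈⇒∼)
    module ∼ = IsEquivalence θ.isEquivalence

    -- Antitonicity is not an identity; it passes to the quotient because y can
    -- be replaced by the congruent element x + y, which is above x in R.
    α-antitone-∼ : ∀ {x y} → (x + y) ∼ y → (α y + α x) ∼ α x
    α-antitone-∼ {x} {y} x+y∼y =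
      ∼.trans (θ.+-cong (θ.α-cong (∼.sym x+y∼y)) ∼.refl)
              (≈⇒∼ (α-antitone (x≤x+y x y)))

  -- If `x` and `y` are θ-congruent, both witness terms at `x`, `y`, `a` lie in the θ-class of `a`,
  -- hence in its φ-class. The witness property modulo φ then makes `x` and `y` φ-congruent.
  class-⊆⇒congruence-⇒ :
    ∀ {ℓ₁ ℓ₂} (θ : Congruence raw ℓ₁) (φ : Congruence raw ℓ₂) (a : Carrier) →
    Congruence.[_] θ a ⊆ Congruence.[_] φ a →
    Congruence._∼_ θ ⇒ Congruence._∼_ φ
  class-⊆⇒congruence-⇒ θ φ a [a]θ⊆[a]φ {x} {y} xθy =
    Properties.witnesses⇒≈ (quotient φ)
      -- Membership in the class of `a` has `a` on the left, while the witness equations have it on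
      -- the right; hence the two symmetries.
      (φ.sym ([a]θ⊆[a]φ (θ.sym (proj₁ t∼a))))
      (φ.sym ([a]θ⊆[a]φ (θ.sym (proj₂ t∼a))))
    where
    module θ = IsEquivalence (Congruence.isEquivalence θ)
    module φ = IsEquivalence (Congruence.isEquivalence φ)
    t∼a = Properties.≈⇒witnesses (quotient θ) a xθy

theorem7 : ∀ {c ℓ ℓ₁ ℓ₂} (R : ŁukasiewiczNearSemiring c ℓ) →
    let open ŁukasiewiczNearSemiring R in
    (∀ x y z → (t₁ raw x y z ≈ z × t₂ raw x y z ≈ z) ⇔ x ≈ y)
    × CongruenceRegular raw ℓ₁ ℓ₂
theorem7 R =
  (λ x y z → mk⇔ (λ (t₁≈z , t₂≈z) → witnesses⇒≈ t₁≈z t₂≈z) (≈⇒witnesses z)) ,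
  λ θ φ a ([a]θ⊆[a]φ , [a]φ⊆[a]θ) →
    class-⊆⇒congruence-⇒ R θ φ a [a]θ⊆[a]φ ,
    class-⊆⇒congruence-⇒ R φ θ a [a]φ⊆[a]θ
  where open Properties R
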